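{- Every axiom of $\mathrm{EqFSCL}$ is derivable in equational logic from $\mathrm{EqMSCL}$, where $\mathrm{EqMSCL}$ consists of (Neg) $\mathsf F=\neg\mathsf T$, (Or) $x\lor_s y=\neg(\neg x\land_s\neg y)$, (Tand) $\mathsf T\land_s x=x$, (Abs) $x\land_s(x\lor_s y)=x$, (Mem) $(x\lor_s y)\land_s z=(\neg x\land_s(y\land_s z))\lor_s(x\land_s z)$; and $\mathrm{EqFSCL}$ consists of (F1) $\mathsf F=\neg\mathsf T$, (F2) $x\lor_s y=\neg(\neg x\land_s\neg y)$, (F3) $\neg\neg x=x$, (F4) $\mathsf T\land_s x=x$, (F5) $x\lor_s\mathsf F=x$, (F6) $\mathsf F\land_s x=\mathsf F$, (F7) $(x\land_s y)\land_s z=x\land_s(y\land_s z)$, (F8) $\neg x\land_s\mathsf F=x\land_s\mathsf F$, (F9) $(x\land_s\mathsf F)\lor_s y=(x\lor_s\mathsf T)\land_s y$, (F10) $(x\land_s y)\lor_s(z\land_s\mathsf F)=(x\lor_s(z\land_s\mathsf F))\land_s(y\lor_s(z\land_s\mathsf F))$.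
   Context: $A$ is a non-empty set of atoms. Terms are built over the signature $\Sigma_{SCL}(A)=\{\land_s,\lor_s,\neg,\mathsf T,\mathsf F\}\cup A$ (atoms and $\mathsf T,\mathsf F$ constants, $\neg$ unary, $\land_s,\lor_s$ binary sequential conjunction/disjunction) with variables. Derivability is derivability in equational logic. -}

module Defs where

open import Data.Nat using (ℕ)

infixr 6 _∧ₛ_
infixr 5 _∨ₛ_
infix 4 _≐_
infix 2 _⊢_≈_

data Term (A : Set) : Set where
  var  : ℕ → Term A
  atom : A → Term A
  𝐓 𝐅  : Term A
  ¬ₛ   : Term A → Term A
  _∧ₛ_ : Term A → Term A → Term A
  _∨ₛ_ : Term A → Term A → Term A

sub : {A : Set} → (ℕ → Term A) → Term A → Term A
sub σ (var n)   = σ n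
sub σ (atom a)  = atom a
sub σ 𝐓         = 𝐓
sub σ 𝐅         = 𝐅
sub σ (¬ₛ t)    = ¬ₛ (sub σ t)
sub σ (t ∧ₛ u)  = sub σ t ∧ₛ sub σ u
sub σ (t ∨ₛ u)  = sub σ t ∨ₛ sub σ u

record Eqn (A : Set) : Set where
  constructor _≐_
  field
    lhs : Term A
    rhs : Term A
open Eqn public

data _⊢_≈_ {A : Set} (E : Eqn A → Set) : Term A → Term A → Set where
  ax    : ∀ {l r} → E (l ≐ r) → (σ : ℕ → Term A) → E ⊢ sub σ l ≈ sub σ r
  refl  : ∀ {t} → E ⊢ t ≈ t
  sym   : ∀ {t u} → E ⊢ t ≈ u → E ⊢ u ≈ t
  trans : ∀ {t u v} → E ⊢ t ≈ u → E ⊢ u ≈ v → E ⊢ t ≈ v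
  cong¬ : ∀ {t u} → E ⊢ t ≈ u → E ⊢ ¬ₛ t ≈ ¬ₛ u
  cong∧ : ∀ {t t′ u u′} → E ⊢ t ≈ t′ → E ⊢ u ≈ u′ → E ⊢ t ∧ₛ u ≈ t′ ∧ₛ u′
  cong∨ : ∀ {t t′ u u′} → E ⊢ t ≈ t′ → E ⊢ u ≈ u′ → E ⊢ t ∨ₛ u ≈ t′ ∨ₛ u′

module _ {A : Set} where
  x y z : Term A
  x = var 0
  y = var 1
  z = var 2

data EqMSCL {A : Set} : Eqn A → Set where
  Neg : EqMSCL (𝐅 ≐ ¬ₛ 𝐓)
  Or  : EqMSCL (x ∨ₛ y ≐ ¬ₛ (¬ₛ x ∧ₛ ¬ₛ y))
  Tand : EqMSCL (𝐓 ∧ₛ x ≐ x)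
  Abs : EqMSCL (x ∧ₛ (x ∨ₛ y) ≐ x)
  Mem : EqMSCL ((x ∨ₛ y) ∧ₛ z ≐ (¬ₛ x ∧ₛ (y ∧ₛ z)) ∨ₛ (x ∧ₛ z))

data EqFSCL {A : Set} : Eqn A → Set where
  F1  : EqFSCL (𝐅 ≐ ¬ₛ 𝐓)
  F2  : EqFSCL (x ∨ₛ y ≐ ¬ₛ (¬ₛ x ∧ₛ ¬ₛ y))
  F3  : EqFSCL (¬ₛ (¬ₛ x) ≐ x)
  F4  : EqFSCL (𝐓 ∧ₛ x ≐ x)
  F5  : EqFSCL (x ∨ₛ 𝐅 ≐ x)
  F6  : EqFSCL (𝐅 ∧ₛ x ≐ 𝐅)
  F7  : EqFSCL ((x ∧ₛ y) ∧ₛ z ≐ x ∧ₛ (y ∧ₛ z))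
  F8  : EqFSCL (¬ₛ x ∧ₛ 𝐅 ≐ x ∧ₛ 𝐅)
  F9  : EqFSCL ((x ∧ₛ 𝐅) ∨ₛ y ≐ (x ∨ₛ 𝐓) ∧ₛ y)
  F10 : EqFSCL ((x ∧ₛ y) ∨ₛ (z ∧ₛ 𝐅) ≐ (x ∨ₛ (z ∧ₛ 𝐅)) ∧ₛ (y ∨ₛ (z ∧ₛ 𝐅)))

{-# OPTIONS --safe #-}
-- Once double negation is derived, EqMSCL is closed under duality, so every schematic law yields
-- its dual. The key tool is then case distinction on x: the instance y = 𝐓 of Mem reads
-- (x ∨ₛ 𝐓) ∧ₛ p = (¬ₛ x ∧ₛ p) ∨ₛ (x ∧ₛ p), and (x ∨ₛ 𝐓) ∧ₛ p = p whenever p starts by evaluating x.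
-- F7 and F10 follow by simplifying both branches with memory laws such as
-- x ∧ₛ ((x ∧ₛ y) ∧ₛ z) = x ∧ₛ (y ∧ₛ z).
module Submission where

open import Data.Nat using (ℕ; zero; suc)
open import Relation.Binary.Bundles using (Setoid)
import Relation.Binary.Reasoning.Setoid as SetoidReasoning
open import Defs

module _ {A : Set} where

  -- Equational reasoning and closure under substitution

  infix 2 _≈_
  _≈_ : Term A → Term A → Set
  t ≈ u = EqMSCL ⊢ t ≈ u

  private
    variable
      t t′ u u′ : Term A

  ⊢-setoid : Setoid _ _
  ⊢-setoid = record
    { Carrier = Term A
    ; _≈_ = _≈_
    ; isEquivalence = record { refl = refl ; sym = sym ; trans = trans }
    }

  open SetoidReasoning ⊢-setoid

  cong∧ˡ : t ≈ t′ → t ∧ₛ u ≈ t′ ∧ₛ u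
  cong∧ˡ p = cong∧ p refl

  cong∧ʳ : u ≈ u′ → t ∧ₛ u ≈ t ∧ₛ u′
  cong∧ʳ p = cong∧ refl p

  cong∨ˡ : t ≈ t′ → t ∨ₛ u ≈ t′ ∨ₛ u
  cong∨ˡ p = cong∨ p refl

  cong∨ʳ : u ≈ u′ → t ∨ₛ u ≈ t ∨ₛ u′
  cong∨ʳ p = cong∨ refl p

  -- Once an axiom is matched, both its sides are concrete, so applying `τ` after `σ` computes to
  -- the instance under the composed substitution.
  sub-≈ : (τ : ℕ → Term A) → t ≈ u → sub τ t ≈ sub τ u
  sub-≈ τ (ax Neg σ)  = ax Neg (λ n → sub τ (σ n))
  sub-≈ τ (ax Or σ)   = ax Or (λ n → sub τ (σ n))
  sub-≈ τ (ax Tand σ) = ax Tand (λ n → sub τ (σ n))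
  sub-≈ τ (ax Abs σ)  = ax Abs (λ n → sub τ (σ n))
  sub-≈ τ (ax Mem σ)  = ax Mem (λ n → sub τ (σ n))
  sub-≈ τ refl        = refl
  sub-≈ τ (sym p)     = sym (sub-≈ τ p)
  sub-≈ τ (trans p q) = trans (sub-≈ τ p) (sub-≈ τ q)
  sub-≈ τ (cong¬ p)   = cong¬ (sub-≈ τ p)
  sub-≈ τ (cong∧ p q) = cong∧ (sub-≈ τ p) (sub-≈ τ q)
  sub-≈ τ (cong∨ p q) = cong∨ (sub-≈ τ p) (sub-≈ τ q)

  -- Laws are stated for the variables x, y, z and instantiated by p [ a , b , c ].
  env : Term A → Term A → Term A → ℕ → Term A
  env a b c zero          = a
  env a b c (suc zero)    = b
  env a b c (suc (suc _)) = c

  infix 20 _[_] _[_,_] _[_,_,_]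

  _[_,_,_] : t ≈ u → ∀ a b c → sub (env a b c) t ≈ sub (env a b c) u
  p [ a , b , c ] = sub-≈ (env a b c) p

  _[_,_] : t ≈ u → ∀ a b → sub (env a b z) t ≈ sub (env a b z) u
  p [ a , b ] = p [ a , b , z ]

  _[_] : t ≈ u → ∀ a → sub (env a y z) t ≈ sub (env a y z) u
  p [ a ] = p [ a , y , z ]

  -- The axioms as schematic laws

  neg : 𝐅 ≈ ¬ₛ 𝐓
  neg = ax Neg var

  or : x ∨ₛ y ≈ ¬ₛ (¬ₛ x ∧ₛ ¬ₛ y)
  or = ax Or var

  ∧-identityˡ : 𝐓 ∧ₛ x ≈ x
  ∧-identityˡ = ax Tand var

  ∧-absorbs-∨ : x ∧ₛ (x ∨ₛ y) ≈ x
  ∧-absorbs-∨ = ax Abs var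

  mem : (x ∨ₛ y) ∧ₛ z ≈ (¬ₛ x ∧ₛ (y ∧ₛ z)) ∨ₛ (x ∧ₛ z)
  mem = ax Mem var

  -- Double negation

  ∨-zeroˡ : 𝐓 ∨ₛ x ≈ 𝐓
  ∨-zeroˡ = begin
    𝐓 ∨ₛ x          ≈⟨ ∧-identityˡ [ 𝐓 ∨ₛ x ] ⟨
    𝐓 ∧ₛ (𝐓 ∨ₛ x)  ≈⟨ ∧-absorbs-∨ [ 𝐓 , x ] ⟩
    𝐓               ∎

  -- By `Abs`, `𝐅` equals `𝐅 ∧ₛ (𝐅 ∨ₛ x)`; with the first `𝐅` read as `¬ₛ 𝐓`, the negation of this
  -- is, by `Or`, a disjunction that starts with `𝐓`.
  ¬𝐅≈𝐓 : ¬ₛ 𝐅 ≈ 𝐓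
  ¬𝐅≈𝐓 = begin
    ¬ₛ 𝐅                               ≈⟨ cong¬ (∧-absorbs-∨ [ 𝐅 , x ]) ⟨
    ¬ₛ (𝐅 ∧ₛ (𝐅 ∨ₛ x))                ≈⟨ cong¬ (cong∧ neg (or [ 𝐅 , x ])) ⟩
    ¬ₛ (¬ₛ 𝐓 ∧ₛ ¬ₛ (¬ₛ 𝐅 ∧ₛ ¬ₛ x))   ≈⟨ or [ 𝐓 , ¬ₛ 𝐅 ∧ₛ ¬ₛ x ] ⟨
    𝐓 ∨ₛ (¬ₛ 𝐅 ∧ₛ ¬ₛ x)               ≈⟨ ∨-zeroˡ [ ¬ₛ 𝐅 ∧ₛ ¬ₛ x ] ⟩
    𝐓                                  ∎

  𝐅∨x≈¬¬x : 𝐅 ∨ₛ x ≈ ¬ₛ (¬ₛ x)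
  𝐅∨x≈¬¬x = begin
    𝐅 ∨ₛ x               ≈⟨ or [ 𝐅 , x ] ⟩
    ¬ₛ (¬ₛ 𝐅 ∧ₛ ¬ₛ x)   ≈⟨ cong¬ (cong∧ˡ ¬𝐅≈𝐓) ⟩
    ¬ₛ (𝐓 ∧ₛ ¬ₛ x)      ≈⟨ cong¬ (∧-identityˡ [ ¬ₛ x ]) ⟩
    ¬ₛ (¬ₛ x)            ∎

  𝐅∧¬¬x≈𝐅 : 𝐅 ∧ₛ ¬ₛ (¬ₛ x) ≈ 𝐅
  𝐅∧¬¬x≈𝐅 = begin
    𝐅 ∧ₛ ¬ₛ (¬ₛ x)  ≈⟨ cong∧ʳ 𝐅∨x≈¬¬x ⟨
    𝐅 ∧ₛ (𝐅 ∨ₛ x)   ≈⟨ ∧-absorbs-∨ [ 𝐅 , x ] ⟩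
    𝐅                ∎

  [𝐅∧x]∨x≈x : (𝐅 ∧ₛ x) ∨ₛ x ≈ x
  [𝐅∧x]∨x≈x = begin
    (𝐅 ∧ₛ x) ∨ₛ x                       ≈⟨ cong∨ (cong∧ (sym neg) ∧-identityˡ) ∧-identityˡ ⟨
    (¬ₛ 𝐓 ∧ₛ (𝐓 ∧ₛ x)) ∨ₛ (𝐓 ∧ₛ x)    ≈⟨ mem [ 𝐓 , 𝐓 , x ] ⟨
    (𝐓 ∨ₛ 𝐓) ∧ₛ x                       ≈⟨ cong∧ˡ (∨-zeroˡ [ 𝐓 ]) ⟩
    𝐓 ∧ₛ x                               ≈⟨ ∧-identityˡ ⟩
    x                                    ∎

  x∨[𝐅∧x]≈x : x ∨ₛ (𝐅 ∧ₛ x) ≈ x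
  x∨[𝐅∧x]≈x = begin
    x ∨ₛ (𝐅 ∧ₛ x)                       ≈⟨ cong∨ˡ ∧-identityˡ ⟨
    (𝐓 ∧ₛ x) ∨ₛ (𝐅 ∧ₛ x)               ≈⟨ cong∨ˡ (cong∧ ¬𝐅≈𝐓 ∧-identityˡ) ⟨
    (¬ₛ 𝐅 ∧ₛ (𝐓 ∧ₛ x)) ∨ₛ (𝐅 ∧ₛ x)    ≈⟨ mem [ 𝐅 , 𝐓 , x ] ⟨
    (𝐅 ∨ₛ 𝐓) ∧ₛ x                       ≈⟨ cong∧ˡ (𝐅∨x≈¬¬x [ 𝐓 ]) ⟩
    ¬ₛ (¬ₛ 𝐓) ∧ₛ x                      ≈⟨ cong∧ˡ (cong¬ neg) ⟨
    ¬ₛ 𝐅 ∧ₛ x                            ≈⟨ cong∧ˡ ¬𝐅≈𝐓 ⟩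
    𝐓 ∧ₛ x                               ≈⟨ ∧-identityˡ ⟩
    x                                    ∎

  -- A prefix `𝐅 ∨ₛ _` acts as double negation, and `[𝐅∧x]∨x≈x` absorbs it in front of a term that
  -- is already a double negation.
  ¬¬¬¬x≈¬¬x : ¬ₛ (¬ₛ (¬ₛ (¬ₛ x))) ≈ ¬ₛ (¬ₛ x)
  ¬¬¬¬x≈¬¬x = begin
    ¬ₛ (¬ₛ (¬ₛ (¬ₛ x)))                 ≈⟨ 𝐅∨x≈¬¬x [ ¬ₛ (¬ₛ x) ] ⟨
    𝐅 ∨ₛ ¬ₛ (¬ₛ x)                      ≈⟨ cong∨ˡ 𝐅∧¬¬x≈𝐅 ⟨
    (𝐅 ∧ₛ ¬ₛ (¬ₛ x)) ∨ₛ ¬ₛ (¬ₛ x)     ≈⟨ [𝐅∧x]∨x≈x [ ¬ₛ (¬ₛ x) ] ⟩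
    ¬ₛ (¬ₛ x)                            ∎

  -- By `x∨[𝐅∧x]≈x` every term is a disjunction, which `Or` unfolds to a negation; this is the term
  -- under that negation.
  co-negand : Term A → Term A
  co-negand t = ¬ₛ t ∧ₛ ¬ₛ (𝐅 ∧ₛ t)

  ≈¬co-negand : ∀ t → t ≈ ¬ₛ (co-negand t)
  ≈¬co-negand t = begin
    t                  ≈⟨ x∨[𝐅∧x]≈x [ t ] ⟨
    t ∨ₛ (𝐅 ∧ₛ t)     ≈⟨ or [ t , 𝐅 ∧ₛ t ] ⟩
    ¬ₛ (co-negand t)   ∎

  -- Every term is a negation, hence a double negation, and ¬⁴ = ¬².
  ¬-involutive : ¬ₛ (¬ₛ x) ≈ x
  ¬-involutive = begin
    ¬ₛ (¬ₛ x)             ≈⟨ cong¬ (cong¬ x≈¬¬q) ⟩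
    ¬ₛ (¬ₛ (¬ₛ (¬ₛ q)))  ≈⟨ ¬¬¬¬x≈¬¬x [ q ] ⟩
    ¬ₛ (¬ₛ q)             ≈⟨ x≈¬¬q ⟨
    x                     ∎
    where
    q = co-negand (co-negand x)
    x≈¬¬q : x ≈ ¬ₛ (¬ₛ q)
    x≈¬¬q = trans (≈¬co-negand x) (cong¬ (≈¬co-negand (co-negand x)))

  -- Duality

  ∨-identityˡ : 𝐅 ∨ₛ x ≈ x
  ∨-identityˡ = trans 𝐅∨x≈¬¬x ¬-involutive

  deMorgan-∧ : ¬ₛ (x ∧ₛ y) ≈ ¬ₛ x ∨ₛ ¬ₛ y
  deMorgan-∧ = begin
    ¬ₛ (x ∧ₛ y)                     ≈⟨ cong¬ (cong∧ ¬-involutive (¬-involutive [ y ])) ⟨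
    ¬ₛ (¬ₛ (¬ₛ x) ∧ₛ ¬ₛ (¬ₛ y))   ≈⟨ or [ ¬ₛ x , ¬ₛ y ] ⟨
    ¬ₛ x ∨ₛ ¬ₛ y                    ∎

  deMorgan-∨ : ¬ₛ (x ∨ₛ y) ≈ ¬ₛ x ∧ₛ ¬ₛ y
  deMorgan-∨ = trans (cong¬ or) (¬-involutive [ ¬ₛ x ∧ₛ ¬ₛ y ])

  and : x ∧ₛ y ≈ ¬ₛ (¬ₛ x ∨ₛ ¬ₛ y)
  and = trans (sym (¬-involutive [ x ∧ₛ y ])) (cong¬ deMorgan-∧)

  ∨-absorbs-∧ : x ∨ₛ (x ∧ₛ y) ≈ x
  ∨-absorbs-∧ = begin
    x ∨ₛ (x ∧ₛ y)                     ≈⟨ or [ x , x ∧ₛ y ] ⟩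
    ¬ₛ (¬ₛ x ∧ₛ ¬ₛ (x ∧ₛ y))         ≈⟨ cong¬ (cong∧ʳ deMorgan-∧) ⟩
    ¬ₛ (¬ₛ x ∧ₛ (¬ₛ x ∨ₛ ¬ₛ y))     ≈⟨ cong¬ (∧-absorbs-∨ [ ¬ₛ x , ¬ₛ y ]) ⟩
    ¬ₛ (¬ₛ x)                          ≈⟨ ¬-involutive ⟩
    x                                  ∎

  mem-dual : (x ∧ₛ y) ∨ₛ z ≈ (¬ₛ x ∨ₛ (y ∨ₛ z)) ∧ₛ (x ∨ₛ z)
  mem-dual = begin
    (x ∧ₛ y) ∨ₛ z
      ≈⟨ or [ x ∧ₛ y , z ] ⟩
    ¬ₛ (¬ₛ (x ∧ₛ y) ∧ₛ ¬ₛ z)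
      ≈⟨ cong¬ (cong∧ˡ deMorgan-∧) ⟩
    ¬ₛ ((¬ₛ x ∨ₛ ¬ₛ y) ∧ₛ ¬ₛ z)
      ≈⟨ cong¬ (mem [ ¬ₛ x , ¬ₛ y , ¬ₛ z ]) ⟩
    ¬ₛ ((¬ₛ (¬ₛ x) ∧ₛ (¬ₛ y ∧ₛ ¬ₛ z)) ∨ₛ (¬ₛ x ∧ₛ ¬ₛ z))
      ≈⟨ deMorgan-∨ [ ¬ₛ (¬ₛ x) ∧ₛ (¬ₛ y ∧ₛ ¬ₛ z) , ¬ₛ x ∧ₛ ¬ₛ z ] ⟩
    ¬ₛ (¬ₛ (¬ₛ x) ∧ₛ (¬ₛ y ∧ₛ ¬ₛ z)) ∧ₛ ¬ₛ (¬ₛ x ∧ₛ ¬ₛ z)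
      ≈⟨ cong∧ (cong¬ (cong∧ʳ (deMorgan-∨ [ y , z ]))) (or [ x , z ]) ⟨
    ¬ₛ (¬ₛ (¬ₛ x) ∧ₛ ¬ₛ (y ∨ₛ z)) ∧ₛ (x ∨ₛ z)
      ≈⟨ cong∧ˡ (or [ ¬ₛ x , y ∨ₛ z ]) ⟨
    (¬ₛ x ∨ₛ (y ∨ₛ z)) ∧ₛ (x ∨ₛ z)
      ∎

  -- Variables and atoms stay fixed, so the dual of a law in `x`, `y`, `z` is again a schematic law
  -- in the same variables.
  δ : Term A → Term A
  δ (var n)  = var n
  δ (atom a) = atom a
  δ 𝐓        = 𝐅
  δ 𝐅        = 𝐓
  δ (¬ₛ t)   = ¬ₛ (δ t)
  δ (t ∧ₛ u) = δ t ∨ₛ δ u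
  δ (t ∨ₛ u) = δ t ∧ₛ δ u

  dual : t ≈ u → δ t ≈ δ u
  dual (ax Neg σ)  = sym ¬𝐅≈𝐓
  dual (ax Or σ)   = and [ δ (σ 0) , δ (σ 1) ]
  dual (ax Tand σ) = ∨-identityˡ [ δ (σ 0) ]
  dual (ax Abs σ)  = ∨-absorbs-∧ [ δ (σ 0) , δ (σ 1) ]
  dual (ax Mem σ)  = mem-dual [ δ (σ 0) , δ (σ 1) , δ (σ 2) ]
  dual refl        = refl
  dual (sym p)     = sym (dual p)
  dual (trans p q) = trans (dual p) (dual q)
  dual (cong¬ p)   = cong¬ (dual p)
  dual (cong∧ p q) = cong∨ (dual p) (dual q)
  dual (cong∨ p q) = cong∧ (dual p) (dual q)

  -- Constants

  ∧-zeroˡ : 𝐅 ∧ₛ x ≈ 𝐅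
  ∧-zeroˡ = dual ∨-zeroˡ

  ∨-identityʳ : x ∨ₛ 𝐅 ≈ x
  ∨-identityʳ = trans (cong∨ʳ (sym ∧-zeroˡ)) x∨[𝐅∧x]≈x

  ∧-identityʳ : x ∧ₛ 𝐓 ≈ x
  ∧-identityʳ = dual ∨-identityʳ

  ∧-idem : x ∧ₛ x ≈ x
  ∧-idem = trans (cong∧ʳ (sym ∨-identityʳ)) (∧-absorbs-∨ [ x , 𝐅 ])

  ∨-idem : x ∨ₛ x ≈ x
  ∨-idem = dual ∧-idem

  -- This is `Mem` at `z = 𝐓`. Read from right to left it places `y` behind `¬ₛ x ∧ₛ _`, where
  -- conjunction laws such as `Abs` apply.
  [¬x∧y]∨x≈x∨y : (¬ₛ x ∧ₛ y) ∨ₛ x ≈ x ∨ₛ y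
  [¬x∧y]∨x≈x∨y = begin
    (¬ₛ x ∧ₛ y) ∨ₛ x                  ≈⟨ cong∨ (cong∧ʳ (∧-identityʳ [ y ])) ∧-identityʳ ⟨
    (¬ₛ x ∧ₛ (y ∧ₛ 𝐓)) ∨ₛ (x ∧ₛ 𝐓)  ≈⟨ mem [ x , y , 𝐓 ] ⟨
    (x ∨ₛ y) ∧ₛ 𝐓                     ≈⟨ ∧-identityʳ [ x ∨ₛ y ] ⟩
    x ∨ₛ y                             ∎

  ¬x∨x≈x∨𝐓 : ¬ₛ x ∨ₛ x ≈ x ∨ₛ 𝐓
  ¬x∨x≈x∨𝐓 = begin
    ¬ₛ x ∨ₛ x         ≈⟨ cong∨ˡ (∧-identityʳ [ ¬ₛ x ]) ⟨
    (¬ₛ x ∧ₛ 𝐓) ∨ₛ x  ≈⟨ [¬x∧y]∨x≈x∨y [ x , 𝐓 ] ⟩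
    x ∨ₛ 𝐓             ∎

  x∨¬x≈x∨𝐓 : x ∨ₛ ¬ₛ x ≈ x ∨ₛ 𝐓
  x∨¬x≈x∨𝐓 = begin
    x ∨ₛ ¬ₛ x            ≈⟨ [¬x∧y]∨x≈x∨y [ x , ¬ₛ x ] ⟨
    (¬ₛ x ∧ₛ ¬ₛ x) ∨ₛ x  ≈⟨ cong∨ˡ (∧-idem [ ¬ₛ x ]) ⟩
    ¬ₛ x ∨ₛ x            ≈⟨ ¬x∨x≈x∨𝐓 ⟩
    x ∨ₛ 𝐓               ∎

  ¬x∨𝐓≈x∨𝐓 : ¬ₛ x ∨ₛ 𝐓 ≈ x ∨ₛ 𝐓
  ¬x∨𝐓≈x∨𝐓 = begin
    ¬ₛ x ∨ₛ 𝐓          ≈⟨ x∨¬x≈x∨𝐓 [ ¬ₛ x ] ⟨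
    ¬ₛ x ∨ₛ ¬ₛ (¬ₛ x)  ≈⟨ cong∨ʳ ¬-involutive ⟩
    ¬ₛ x ∨ₛ x          ≈⟨ ¬x∨x≈x∨𝐓 ⟩
    x ∨ₛ 𝐓             ∎

  ¬x∧𝐅≈x∧𝐅 : ¬ₛ x ∧ₛ 𝐅 ≈ x ∧ₛ 𝐅
  ¬x∧𝐅≈x∧𝐅 = dual ¬x∨𝐓≈x∨𝐓

  ¬[x∧𝐅]≈x∨𝐓 : ¬ₛ (x ∧ₛ 𝐅) ≈ x ∨ₛ 𝐓
  ¬[x∧𝐅]≈x∨𝐓 = begin
    ¬ₛ (x ∧ₛ 𝐅)   ≈⟨ deMorgan-∧ [ x , 𝐅 ] ⟩
    ¬ₛ x ∨ₛ ¬ₛ 𝐅  ≈⟨ cong∨ʳ ¬𝐅≈𝐓 ⟩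
    ¬ₛ x ∨ₛ 𝐓     ≈⟨ ¬x∨𝐓≈x∨𝐓 ⟩
    x ∨ₛ 𝐓        ∎

  case-split : (x ∨ₛ 𝐓) ∧ₛ y ≈ (¬ₛ x ∧ₛ y) ∨ₛ (x ∧ₛ y)
  case-split = begin
    (x ∨ₛ 𝐓) ∧ₛ y                     ≈⟨ mem [ x , 𝐓 , y ] ⟩
    (¬ₛ x ∧ₛ (𝐓 ∧ₛ y)) ∨ₛ (x ∧ₛ y)  ≈⟨ cong∨ˡ (cong∧ʳ (∧-identityˡ [ y ])) ⟩
    (¬ₛ x ∧ₛ y) ∨ₛ (x ∧ₛ y)          ∎

  -- `x ∧ₛ 𝐅` evaluates `x` and never yields true, so it may precede a term that starts by
  -- evaluating `x`. Formally this is `Mem` at `y = 𝐅`.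
  [x∧𝐅]∨[x∧y]≈x∧y : (x ∧ₛ 𝐅) ∨ₛ (x ∧ₛ y) ≈ x ∧ₛ y
  [x∧𝐅]∨[x∧y]≈x∧y = begin
    (x ∧ₛ 𝐅) ∨ₛ (x ∧ₛ y)              ≈⟨ cong∨ˡ ¬x∧𝐅≈x∧𝐅 ⟨
    (¬ₛ x ∧ₛ 𝐅) ∨ₛ (x ∧ₛ y)           ≈⟨ cong∨ˡ (cong∧ʳ (∧-zeroˡ [ y ])) ⟨
    (¬ₛ x ∧ₛ (𝐅 ∧ₛ y)) ∨ₛ (x ∧ₛ y)   ≈⟨ mem [ x , 𝐅 , y ] ⟨
    (x ∨ₛ 𝐅) ∧ₛ y                      ≈⟨ cong∧ˡ ∨-identityʳ ⟩
    x ∧ₛ y                              ∎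

  [x∨𝐓]∧𝐅≈x∧𝐅 : (x ∨ₛ 𝐓) ∧ₛ 𝐅 ≈ x ∧ₛ 𝐅
  [x∨𝐓]∧𝐅≈x∧𝐅 = begin
    (x ∨ₛ 𝐓) ∧ₛ 𝐅              ≈⟨ case-split [ x , 𝐅 ] ⟩
    (¬ₛ x ∧ₛ 𝐅) ∨ₛ (x ∧ₛ 𝐅)   ≈⟨ cong∨ˡ ¬x∧𝐅≈x∧𝐅 ⟩
    (x ∧ₛ 𝐅) ∨ₛ (x ∧ₛ 𝐅)      ≈⟨ ∨-idem [ x ∧ₛ 𝐅 ] ⟩
    x ∧ₛ 𝐅                      ∎

  [x∧𝐅]∨𝐓≈x∨𝐓 : (x ∧ₛ 𝐅) ∨ₛ 𝐓 ≈ x ∨ₛ 𝐓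
  [x∧𝐅]∨𝐓≈x∨𝐓 = dual [x∨𝐓]∧𝐅≈x∧𝐅

  -- The conjunct `y` is never reached. This special case of associativity comes from absorption
  -- once `f ∧ₛ 𝐅 ≈ f`, and the proof of `∧-assoc` relies on it.
  [x∧𝐅]∧y≈x∧𝐅 : (x ∧ₛ 𝐅) ∧ₛ y ≈ x ∧ₛ 𝐅
  [x∧𝐅]∧y≈x∧𝐅 = begin
    f ∧ₛ y                   ≈⟨ [x∧𝐅]∨[x∧y]≈x∧y [ f , y ] ⟨
    (f ∧ₛ 𝐅) ∨ₛ (f ∧ₛ y)    ≈⟨ cong∨ˡ f∧𝐅≈f ⟩
    f ∨ₛ (f ∧ₛ y)            ≈⟨ ∨-absorbs-∧ [ f , y ] ⟩
    f                         ∎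
    where
    f = x ∧ₛ 𝐅
    f∧𝐅≈f : f ∧ₛ 𝐅 ≈ f
    f∧𝐅≈f = begin
      f ∧ₛ 𝐅          ≈⟨ [x∨𝐓]∧𝐅≈x∧𝐅 [ f ] ⟨
      (f ∨ₛ 𝐓) ∧ₛ 𝐅  ≈⟨ cong∧ˡ [x∧𝐅]∨𝐓≈x∨𝐓 ⟩
      (x ∨ₛ 𝐓) ∧ₛ 𝐅  ≈⟨ [x∨𝐓]∧𝐅≈x∧𝐅 ⟩
      f                ∎

  -- Memory

  -- `Mem` copies the right conjunct into both branches, and `Abs` collapses the branch where `x`
  -- holds. Many of the memory laws below rest on this left distributivity.
  x∨[y∧[x∨z]] : x ∨ₛ (y ∧ₛ (x ∨ₛ z)) ≈ (x ∨ₛ y) ∧ₛ (x ∨ₛ z)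
  x∨[y∧[x∨z]] = begin
    x ∨ₛ (y ∧ₛ (x ∨ₛ z))
      ≈⟨ [¬x∧y]∨x≈x∨y [ x , y ∧ₛ (x ∨ₛ z) ] ⟨
    (¬ₛ x ∧ₛ (y ∧ₛ (x ∨ₛ z))) ∨ₛ x
      ≈⟨ cong∨ʳ (∧-absorbs-∨ [ x , z ]) ⟨
    (¬ₛ x ∧ₛ (y ∧ₛ (x ∨ₛ z))) ∨ₛ (x ∧ₛ (x ∨ₛ z))
      ≈⟨ mem [ x , y , x ∨ₛ z ] ⟨
    (x ∨ₛ y) ∧ₛ (x ∨ₛ z)
      ∎

  x∨[x∨y]≈x∨y : x ∨ₛ (x ∨ₛ y) ≈ x ∨ₛ y
  x∨[x∨y]≈x∨y = begin
    x ∨ₛ (x ∨ₛ y)           ≈⟨ cong∨ʳ (∧-identityˡ [ x ∨ₛ y ]) ⟨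
    x ∨ₛ (𝐓 ∧ₛ (x ∨ₛ y))   ≈⟨ x∨[y∧[x∨z]] [ x , 𝐓 , y ] ⟩
    (x ∨ₛ 𝐓) ∧ₛ (x ∨ₛ y)   ≈⟨ dual [x∧𝐅]∨[x∧y]≈x∧y ⟩
    x ∨ₛ y                   ∎

  x∨[¬x∨y]≈x∨𝐓 : x ∨ₛ (¬ₛ x ∨ₛ y) ≈ x ∨ₛ 𝐓
  x∨[¬x∨y]≈x∨𝐓 = begin
    x ∨ₛ (¬ₛ x ∨ₛ y)             ≈⟨ [¬x∧y]∨x≈x∨y [ x , ¬ₛ x ∨ₛ y ] ⟨
    (¬ₛ x ∧ₛ (¬ₛ x ∨ₛ y)) ∨ₛ x  ≈⟨ cong∨ˡ (∧-absorbs-∨ [ ¬ₛ x , y ]) ⟩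
    ¬ₛ x ∨ₛ x                     ≈⟨ ¬x∨x≈x∨𝐓 ⟩
    x ∨ₛ 𝐓                        ∎

  -- Behind `x ∨ₛ _` the test `x` has failed, so `x ∧ₛ y` cannot reach `y`. `mem-dual` supplies the
  -- second `x ∨ₛ z` that left distributivity requires.
  x∨[[x∧y]∨z]≈x∨z : x ∨ₛ ((x ∧ₛ y) ∨ₛ z) ≈ x ∨ₛ z
  x∨[[x∧y]∨z]≈x∨z = begin
    x ∨ₛ ((x ∧ₛ y) ∨ₛ z)                         ≈⟨ cong∨ʳ mem-dual ⟩
    x ∨ₛ ((¬ₛ x ∨ₛ (y ∨ₛ z)) ∧ₛ (x ∨ₛ z))      ≈⟨ x∨[y∧[x∨z]] [ x , ¬ₛ x ∨ₛ (y ∨ₛ z) , z ] ⟩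
    (x ∨ₛ (¬ₛ x ∨ₛ (y ∨ₛ z))) ∧ₛ (x ∨ₛ z)      ≈⟨ cong∧ˡ (x∨[¬x∨y]≈x∨𝐓 [ x , y ∨ₛ z ]) ⟩
    (x ∨ₛ 𝐓) ∧ₛ (x ∨ₛ z)                         ≈⟨ dual [x∧𝐅]∨[x∧y]≈x∧y [ x , z ] ⟩
    x ∨ₛ z                                         ∎

  x∨[¬x∧y]≈x∨y : x ∨ₛ (¬ₛ x ∧ₛ y) ≈ x ∨ₛ y
  x∨[¬x∧y]≈x∨y = begin
    x ∨ₛ (¬ₛ x ∧ₛ y)             ≈⟨ [¬x∧y]∨x≈x∨y [ x , ¬ₛ x ∧ₛ y ] ⟨
    (¬ₛ x ∧ₛ (¬ₛ x ∧ₛ y)) ∨ₛ x  ≈⟨ cong∨ˡ (dual x∨[x∨y]≈x∨y [ ¬ₛ x , y ]) ⟩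
    (¬ₛ x ∧ₛ y) ∨ₛ x             ≈⟨ [¬x∧y]∨x≈x∨y ⟩
    x ∨ₛ y                        ∎

  mem-¬ : (¬ₛ x ∨ₛ y) ∧ₛ z ≈ (x ∧ₛ (y ∧ₛ z)) ∨ₛ (¬ₛ x ∧ₛ z)
  mem-¬ = trans (mem [ ¬ₛ x , y , z ]) (cong∨ˡ (cong∧ˡ ¬-involutive))

  x∨[[¬x∨y]∧z]≈x∨z : x ∨ₛ ((¬ₛ x ∨ₛ y) ∧ₛ z) ≈ x ∨ₛ z
  x∨[[¬x∨y]∧z]≈x∨z = begin
    x ∨ₛ ((¬ₛ x ∨ₛ y) ∧ₛ z)                     ≈⟨ cong∨ʳ mem-¬ ⟩
    x ∨ₛ ((x ∧ₛ (y ∧ₛ z)) ∨ₛ (¬ₛ x ∧ₛ z))     ≈⟨ x∨[[x∧y]∨z]≈x∨z [ x , y ∧ₛ z , ¬ₛ x ∧ₛ z ] ⟩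
    x ∨ₛ (¬ₛ x ∧ₛ z)                             ≈⟨ x∨[¬x∧y]≈x∨y [ x , z ] ⟩
    x ∨ₛ z                                        ∎

  [x∨y]∧y≈[x∨𝐓]∧y : (x ∨ₛ y) ∧ₛ y ≈ (x ∨ₛ 𝐓) ∧ₛ y
  [x∨y]∧y≈[x∨𝐓]∧y = begin
    (x ∨ₛ y) ∧ₛ y                      ≈⟨ mem [ x , y , y ] ⟩
    (¬ₛ x ∧ₛ (y ∧ₛ y)) ∨ₛ (x ∧ₛ y)   ≈⟨ cong∨ˡ (cong∧ʳ (∧-idem [ y ])) ⟩
    (¬ₛ x ∧ₛ y) ∨ₛ (x ∧ₛ y)           ≈⟨ case-split ⟨
    (x ∨ₛ 𝐓) ∧ₛ y                      ∎

  -- Both sides evaluate `x`, discard its value and return `y`. With the sides named `f ∨ₛ y` and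
  -- `g`, the first equals `g ∨ₛ y`, so it remains to collapse `g ∨ₛ y` to `g`.
  [x∧𝐅]∨y≈[x∨𝐓]∧y : (x ∧ₛ 𝐅) ∨ₛ y ≈ (x ∨ₛ 𝐓) ∧ₛ y
  [x∧𝐅]∨y≈[x∨𝐓]∧y = begin
    f ∨ₛ y                  ≈⟨ g∨y≈f∨y ⟨
    -- Behind `g ∨ₛ _` the guard `¬ₛ g ∨ₛ g` may be put before `y`. In front of `y` it is exchanged
    -- for `g ∨ₛ y`, then `f ∨ₛ y`, and finally `x ∨ₛ 𝐓`, which makes the guarded `y` into `g`.
    g ∨ₛ y                  ≈⟨ x∨[[¬x∨y]∧z]≈x∨z [ g , g , y ] ⟨
    g ∨ₛ ((¬ₛ g ∨ₛ g) ∧ₛ y) ≈⟨ cong∨ʳ (cong∧ˡ (¬x∨x≈x∨𝐓 [ g ])) ⟩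
    g ∨ₛ ((g ∨ₛ 𝐓) ∧ₛ y)   ≈⟨ cong∨ʳ ([x∨y]∧y≈[x∨𝐓]∧y [ g , y ]) ⟨
    g ∨ₛ ((g ∨ₛ y) ∧ₛ y)   ≈⟨ cong∨ʳ (cong∧ˡ g∨y≈f∨y) ⟩
    g ∨ₛ ((f ∨ₛ y) ∧ₛ y)   ≈⟨ cong∨ʳ ([x∨y]∧y≈[x∨𝐓]∧y [ f , y ]) ⟩
    g ∨ₛ ((f ∨ₛ 𝐓) ∧ₛ y)   ≈⟨ cong∨ʳ (cong∧ˡ [x∧𝐅]∨𝐓≈x∨𝐓) ⟩
    g ∨ₛ g                  ≈⟨ ∨-idem [ g ] ⟩
    g                        ∎
    where
    f = x ∧ₛ 𝐅
    g = (x ∨ₛ 𝐓) ∧ₛ y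
    g∨y≈f∨y : g ∨ₛ y ≈ f ∨ₛ y
    g∨y≈f∨y = begin
      g ∨ₛ y                  ≈⟨ dual [x∨y]∧y≈[x∨𝐓]∧y [ x ∨ₛ 𝐓 , y ] ⟩
      ((x ∨ₛ 𝐓) ∧ₛ 𝐅) ∨ₛ y  ≈⟨ cong∨ˡ [x∨𝐓]∧𝐅≈x∧𝐅 ⟩
      f ∨ₛ y                  ∎

  [x∨𝐓]∧[x∧y]≈x∧y : (x ∨ₛ 𝐓) ∧ₛ (x ∧ₛ y) ≈ x ∧ₛ y
  [x∨𝐓]∧[x∧y]≈x∧y = trans (sym ([x∧𝐅]∨y≈[x∨𝐓]∧y [ x , x ∧ₛ y ])) [x∧𝐅]∨[x∧y]≈x∧y

  -- `Mem` applied to `(f ∨ₛ x) ∧ₛ y` produces the trailing disjunct, while `f ∨ₛ x` is just `x`.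
  [x∧y]∨[x∧𝐅]≈x∧y : (x ∧ₛ y) ∨ₛ (x ∧ₛ 𝐅) ≈ x ∧ₛ y
  [x∧y]∨[x∧𝐅]≈x∧y = begin
    (x ∧ₛ y) ∨ₛ f                         ≈⟨ cong∨ [x∨𝐓]∧[x∧y]≈x∧y [x∧𝐅]∧y≈x∧𝐅 ⟨
    ((x ∨ₛ 𝐓) ∧ₛ (x ∧ₛ y)) ∨ₛ (f ∧ₛ y)  ≈⟨ cong∨ˡ (cong∧ˡ ¬[x∧𝐅]≈x∨𝐓) ⟨
    (¬ₛ f ∧ₛ (x ∧ₛ y)) ∨ₛ (f ∧ₛ y)       ≈⟨ mem [ f , x , y ] ⟨
    (f ∨ₛ x) ∧ₛ y                          ≈⟨ cong∧ˡ f∨x≈x ⟩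
    x ∧ₛ y                                  ∎
    where
    f = x ∧ₛ 𝐅
    f∨x≈x : f ∨ₛ x ≈ x
    f∨x≈x = begin
      f ∨ₛ x             ≈⟨ cong∨ˡ ¬x∧𝐅≈x∧𝐅 ⟨
      (¬ₛ x ∧ₛ 𝐅) ∨ₛ x  ≈⟨ [¬x∧y]∨x≈x∨y [ x , 𝐅 ] ⟩
      x ∨ₛ 𝐅             ≈⟨ ∨-identityʳ ⟩
      x                   ∎

  -- The harmless trailing disjunct `x ∧ₛ 𝐅` equals `¬ₛ x ∧ₛ x`, which completes the right-hand side
  -- of `mem-¬` for `(¬ₛ x ∨ₛ y) ∧ₛ x`.
  x∧[y∧x]≈x∧y : x ∧ₛ (y ∧ₛ x) ≈ x ∧ₛ y
  x∧[y∧x]≈x∧y = begin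
    x ∧ₛ (y ∧ₛ x)                     ≈⟨ [x∧y]∨[x∧𝐅]≈x∧y [ x , y ∧ₛ x ] ⟨
    (x ∧ₛ (y ∧ₛ x)) ∨ₛ (x ∧ₛ 𝐅)     ≈⟨ cong∨ʳ (dual ¬x∨x≈x∨𝐓) ⟨
    (x ∧ₛ (y ∧ₛ x)) ∨ₛ (¬ₛ x ∧ₛ x)  ≈⟨ mem-¬ [ x , y , x ] ⟨
    (¬ₛ x ∨ₛ y) ∧ₛ x                  ≈⟨ dual [¬x∧y]∨x≈x∨y ⟩
    x ∧ₛ y                             ∎

  -- A copy of the true test `¬ₛ x ∨ₛ z` is inserted before `y`, makes the trailing one redundant by
  -- `x∧[y∧x]≈x∧y`, and is removed again.
  x∨[y∧[¬x∨z]]≈x∨y : x ∨ₛ (y ∧ₛ (¬ₛ x ∨ₛ z)) ≈ x ∨ₛ y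
  x∨[y∧[¬x∨z]]≈x∨y = begin
    x ∨ₛ (y ∧ₛ i)            ≈⟨ x∨[[¬x∨y]∧z]≈x∨z [ x , z , y ∧ₛ i ] ⟨
    x ∨ₛ (i ∧ₛ (y ∧ₛ i))    ≈⟨ cong∨ʳ (x∧[y∧x]≈x∧y [ i , y ]) ⟩
    x ∨ₛ (i ∧ₛ y)            ≈⟨ x∨[[¬x∨y]∧z]≈x∨z [ x , z , y ] ⟩
    x ∨ₛ y                    ∎
    where
    i = ¬ₛ x ∨ₛ z

  x∧[y∧[x∨z]]≈x∧y : x ∧ₛ (y ∧ₛ (x ∨ₛ z)) ≈ x ∧ₛ y
  x∧[y∧[x∨z]]≈x∧y = begin
    x ∧ₛ (y ∧ₛ (x ∨ₛ z))                 ≈⟨ dual x∨[[x∧y]∨z]≈x∨z [ x , z , y ∧ₛ (x ∨ₛ z) ] ⟨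
    x ∧ₛ ((x ∨ₛ z) ∧ₛ (y ∧ₛ (x ∨ₛ z)))  ≈⟨ cong∧ʳ (x∧[y∧x]≈x∧y [ x ∨ₛ z , y ]) ⟩
    x ∧ₛ ((x ∨ₛ z) ∧ₛ y)                 ≈⟨ dual x∨[[x∧y]∨z]≈x∨z [ x , z , y ] ⟩
    x ∧ₛ y                                 ∎

  x∨[[¬x∧y]∨z]≈x∨[y∨z] : x ∨ₛ ((¬ₛ x ∧ₛ y) ∨ₛ z) ≈ x ∨ₛ (y ∨ₛ z)
  x∨[[¬x∧y]∨z]≈x∨[y∨z] = begin
    x ∨ₛ ((¬ₛ x ∧ₛ y) ∨ₛ z)                    ≈⟨ cong∨ʳ (dual mem-¬) ⟩
    x ∨ₛ ((x ∨ₛ (y ∨ₛ z)) ∧ₛ (¬ₛ x ∨ₛ z))     ≈⟨ x∨[y∧[¬x∨z]]≈x∨y [ x , x ∨ₛ (y ∨ₛ z) , z ] ⟩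
    x ∨ₛ (x ∨ₛ (y ∨ₛ z))                        ≈⟨ x∨[x∨y]≈x∨y [ x , y ∨ₛ z ] ⟩
    x ∨ₛ (y ∨ₛ z)                                ∎

  x∧[[¬x∨y]∧z]≈x∧[y∧z] : x ∧ₛ ((¬ₛ x ∨ₛ y) ∧ₛ z) ≈ x ∧ₛ (y ∧ₛ z)
  x∧[[¬x∨y]∧z]≈x∧[y∧z] = dual x∨[[¬x∧y]∨z]≈x∨[y∨z]

  x∧[[x∧y]∧z]≈x∧[y∧z] : x ∧ₛ ((x ∧ₛ y) ∧ₛ z) ≈ x ∧ₛ (y ∧ₛ z)
  x∧[[x∧y]∧z]≈x∧[y∧z] = begin
    x ∧ₛ ((x ∧ₛ y) ∧ₛ z)             ≈⟨ x∧[[¬x∨y]∧z]≈x∧[y∧z] [ x , x ∧ₛ y , z ] ⟨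
    x ∧ₛ ((¬ₛ x ∨ₛ (x ∧ₛ y)) ∧ₛ z)  ≈⟨ cong∧ʳ (cong∧ˡ ¬x∨[x∧y]≈¬x∨y) ⟩
    x ∧ₛ ((¬ₛ x ∨ₛ y) ∧ₛ z)          ≈⟨ x∧[[¬x∨y]∧z]≈x∧[y∧z] ⟩
    x ∧ₛ (y ∧ₛ z)                     ∎
    where
    ¬x∨[x∧y]≈¬x∨y : ¬ₛ x ∨ₛ (x ∧ₛ y) ≈ ¬ₛ x ∨ₛ y
    ¬x∨[x∧y]≈¬x∨y =
      trans (cong∨ʳ (cong∧ˡ (sym ¬-involutive))) (x∨[¬x∧y]≈x∨y [ ¬ₛ x , y ])

  ¬x∧[[x∧y]∧z]≈x∧𝐅 : ¬ₛ x ∧ₛ ((x ∧ₛ y) ∧ₛ z) ≈ x ∧ₛ 𝐅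
  ¬x∧[[x∧y]∧z]≈x∧𝐅 = begin
    ¬ₛ x ∧ₛ ((x ∧ₛ y) ∧ₛ z)
      -- The memory law is used backwards to bring `¬ₛ x` next to `x ∧ₛ y`, where the two
      -- contradictory tests collapse to `¬ₛ x ∧ₛ 𝐅`.
      ≈⟨ x∧[[x∧y]∧z]≈x∧[y∧z] [ ¬ₛ x , x ∧ₛ y , z ] ⟨
    ¬ₛ x ∧ₛ ((¬ₛ x ∧ₛ (x ∧ₛ y)) ∧ₛ z)
      ≈⟨ cong∧ʳ (cong∧ˡ (cong∧ʳ (cong∧ˡ ¬-involutive))) ⟨
    ¬ₛ x ∧ₛ ((¬ₛ x ∧ₛ (¬ₛ (¬ₛ x) ∧ₛ y)) ∧ₛ z)
      ≈⟨ cong∧ʳ (cong∧ˡ (dual x∨[¬x∨y]≈x∨𝐓 [ ¬ₛ x , y ])) ⟩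
    ¬ₛ x ∧ₛ ((¬ₛ x ∧ₛ 𝐅) ∧ₛ z)
      ≈⟨ cong∧ʳ ([x∧𝐅]∧y≈x∧𝐅 [ ¬ₛ x , z ]) ⟩
    ¬ₛ x ∧ₛ (¬ₛ x ∧ₛ 𝐅)
      ≈⟨ dual x∨[x∨y]≈x∨y [ ¬ₛ x , 𝐅 ] ⟩
    ¬ₛ x ∧ₛ 𝐅
      ≈⟨ ¬x∧𝐅≈x∧𝐅 ⟩
    x ∧ₛ 𝐅
      ∎

  -- Associativity and distributivity

  -- The term evaluates `x` first, but before associativity `x` is not its outermost left operand.
  -- Rewriting it as `f ∨ₛ (p ∨ₛ f)` puts `f = x ∧ₛ 𝐅` in front, and a further `f` is then absorbed.
  [x∨𝐓]∧[[x∧y]∧z]≈[x∧y]∧z : (x ∨ₛ 𝐓) ∧ₛ ((x ∧ₛ y) ∧ₛ z) ≈ (x ∧ₛ y) ∧ₛ z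
  [x∨𝐓]∧[[x∧y]∧z]≈[x∧y]∧z = begin
    (x ∨ₛ 𝐓) ∧ₛ p        ≈⟨ [x∧𝐅]∨y≈[x∨𝐓]∧y [ x , p ] ⟨
    f ∨ₛ p                ≈⟨ cong∨ʳ p≈f∨[p∨f] ⟩
    f ∨ₛ (f ∨ₛ (p ∨ₛ f)) ≈⟨ x∨[x∨y]≈x∨y [ f , p ∨ₛ f ] ⟩
    f ∨ₛ (p ∨ₛ f)         ≈⟨ p≈f∨[p∨f] ⟨
    p                      ∎
    where
    f = x ∧ₛ 𝐅
    p = (x ∧ₛ y) ∧ₛ z
    p≈f∨[p∨f] : p ≈ f ∨ₛ (p ∨ₛ f)
    p≈f∨[p∨f] = begin
      p                                        ≈⟨ cong∧ˡ [x∧𝐅]∨[x∧y]≈x∧y ⟨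
      (f ∨ₛ (x ∧ₛ y)) ∧ₛ z                    ≈⟨ mem [ f , x ∧ₛ y , z ] ⟩
      (¬ₛ f ∧ₛ p) ∨ₛ (f ∧ₛ z)                 ≈⟨ cong∨ʳ ([x∧𝐅]∧y≈x∧𝐅 [ x , z ]) ⟩
      (¬ₛ f ∧ₛ p) ∨ₛ f                         ≈⟨ dual mem-¬ [ f , p , f ] ⟩
      (f ∨ₛ (p ∨ₛ f)) ∧ₛ (¬ₛ f ∨ₛ f)          ≈⟨ cong∧ʳ (¬x∨x≈x∨𝐓 [ f ]) ⟩
      (f ∨ₛ (p ∨ₛ f)) ∧ₛ (f ∨ₛ 𝐓)             ≈⟨ dual [x∧y]∨[x∧𝐅]≈x∧y [ f , p ∨ₛ f ] ⟩
      f ∨ₛ (p ∨ₛ f)                            ∎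

  ∧-assoc : (x ∧ₛ y) ∧ₛ z ≈ x ∧ₛ (y ∧ₛ z)
  ∧-assoc = begin
    p                           ≈⟨ [x∨𝐓]∧[[x∧y]∧z]≈[x∧y]∧z ⟨
    (x ∨ₛ 𝐓) ∧ₛ p              ≈⟨ case-split [ x , p ] ⟩
    (¬ₛ x ∧ₛ p) ∨ₛ (x ∧ₛ p)   ≈⟨ cong∨ ¬x∧[[x∧y]∧z]≈x∧𝐅 x∧[[x∧y]∧z]≈x∧[y∧z] ⟩
    (x ∧ₛ 𝐅) ∨ₛ (x ∧ₛ (y ∧ₛ z)) ≈⟨ [x∧𝐅]∨[x∧y]≈x∧y [ x , y ∧ₛ z ] ⟩
    x ∧ₛ (y ∧ₛ z)              ∎
    where
    p = (x ∧ₛ y) ∧ₛ z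

  [x∨𝐓]∧[[x∧y]∨z]≈[x∧y]∨z : (x ∨ₛ 𝐓) ∧ₛ ((x ∧ₛ y) ∨ₛ z) ≈ (x ∧ₛ y) ∨ₛ z
  [x∨𝐓]∧[[x∧y]∨z]≈[x∧y]∨z = begin
    (x ∨ₛ 𝐓) ∧ₛ ((x ∧ₛ y) ∨ₛ z)   ≈⟨ [x∧𝐅]∨y≈[x∨𝐓]∧y [ x , (x ∧ₛ y) ∨ₛ z ] ⟨
    (x ∧ₛ 𝐅) ∨ₛ ((x ∧ₛ y) ∨ₛ z)   ≈⟨ dual ∧-assoc [ x ∧ₛ 𝐅 , x ∧ₛ y , z ] ⟨
    ((x ∧ₛ 𝐅) ∨ₛ (x ∧ₛ y)) ∨ₛ z   ≈⟨ cong∨ˡ [x∧𝐅]∨[x∧y]≈x∧y ⟩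
    (x ∧ₛ y) ∨ₛ z                   ∎

  x∧[[x∧y]∨z]≈x∧[y∨z] : x ∧ₛ ((x ∧ₛ y) ∨ₛ z) ≈ x ∧ₛ (y ∨ₛ z)
  x∧[[x∧y]∨z]≈x∧[y∨z] = begin
    x ∧ₛ ((x ∧ₛ y) ∨ₛ z)                      ≈⟨ cong∧ʳ mem-dual ⟩
    x ∧ₛ ((¬ₛ x ∨ₛ (y ∨ₛ z)) ∧ₛ (x ∨ₛ z))   ≈⟨ x∧[[¬x∨y]∧z]≈x∧[y∧z] [ x , y ∨ₛ z , x ∨ₛ z ] ⟩
    x ∧ₛ ((y ∨ₛ z) ∧ₛ (x ∨ₛ z))              ≈⟨ x∧[y∧[x∨z]]≈x∧y [ x , y ∨ₛ z , z ] ⟩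
    x ∧ₛ (y ∨ₛ z)                              ∎

  ¬x∧[[x∧y]∨z]≈¬x∧z : ¬ₛ x ∧ₛ ((x ∧ₛ y) ∨ₛ z) ≈ ¬ₛ x ∧ₛ z
  ¬x∧[[x∧y]∨z]≈¬x∧z = begin
    ¬ₛ x ∧ₛ ((x ∧ₛ y) ∨ₛ z)             ≈⟨ cong∧ʳ (cong∨ˡ (cong∧ˡ ¬-involutive)) ⟨
    ¬ₛ x ∧ₛ ((¬ₛ (¬ₛ x) ∧ₛ y) ∨ₛ z)   ≈⟨ dual x∨[[¬x∨y]∧z]≈x∨z [ ¬ₛ x , y , z ] ⟩
    ¬ₛ x ∧ₛ z                            ∎

  ∨[z∧𝐅]-distribʳ-∧ :
    (x ∧ₛ y) ∨ₛ (z ∧ₛ 𝐅) ≈ (x ∨ₛ (z ∧ₛ 𝐅)) ∧ₛ (y ∨ₛ (z ∧ₛ 𝐅))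
  ∨[z∧𝐅]-distribʳ-∧ = begin
    p
      ≈⟨ [x∨𝐓]∧[[x∧y]∨z]≈[x∧y]∨z [ x , y , f ] ⟨
    (x ∨ₛ 𝐓) ∧ₛ p
      ≈⟨ case-split [ x , p ] ⟩
    (¬ₛ x ∧ₛ p) ∨ₛ (x ∧ₛ p)
      ≈⟨ cong∨ (¬x∧[[x∧y]∨z]≈¬x∧z [ x , y , f ]) (x∧[[x∧y]∨z]≈x∧[y∨z] [ x , y , f ]) ⟩
    (¬ₛ x ∧ₛ f) ∨ₛ (x ∧ₛ (y ∨ₛ f))
      -- Since `f` never yields true, it can be extended to `f ∧ₛ (y ∨ₛ f)`; both branches then end
      -- in `y ∨ₛ f`, as `Mem` requires.
      ≈⟨ cong∨ˡ (cong∧ʳ ([x∧𝐅]∧y≈x∧𝐅 [ z , y ∨ₛ f ])) ⟨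
    (¬ₛ x ∧ₛ (f ∧ₛ (y ∨ₛ f))) ∨ₛ (x ∧ₛ (y ∨ₛ f))
      ≈⟨ mem [ x , f , y ∨ₛ f ] ⟨
    (x ∨ₛ f) ∧ₛ (y ∨ₛ f)
      ∎
    where
    f = z ∧ₛ 𝐅
    p = (x ∧ₛ y) ∨ₛ f

theorem3p4 : {A : Set} → A → (e : Eqn A) → EqFSCL e → EqMSCL ⊢ lhs e ≈ rhs e
theorem3p4 _ _ F1  = neg
theorem3p4 _ _ F2  = or
theorem3p4 _ _ F3  = ¬-involutive
theorem3p4 _ _ F4  = ∧-identityˡ
theorem3p4 _ _ F5  = ∨-identityʳ
theorem3p4 _ _ F6  = ∧-zeroˡ
theorem3p4 _ _ F7  = ∧-assoc
theorem3p4 _ _ F8  = ¬x∧𝐅≈x∧𝐅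
theorem3p4 _ _ F9  = [x∧𝐅]∨y≈[x∨𝐓]∧y
theorem3p4 _ _ F10 = ∨[z∧𝐅]-distribʳ-∧
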